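{- Let $t$ be an integer and let $G$ be a graph. (1) If every induced bipartite subgraph of $G$, with bipartition $(A,B)$, has a proper odd coloring $c$ with $|c(A)|\le t$ and $|c(B)|\le t$, then $\chi_{\mathrm{o}}(G)\le t^2\chi(G)-2t(t-1)$. (2) If every induced bipartite subgraph of $G$, with bipartition $(A,B)$, has a proper conflict-free coloring $c$ with $|c(A)|\le t$ and $|c(B)|\le t$, then $\chi_{\mathrm{pcf}}(G)\le t^2\chi(G)-2t(t-1)$.
   Context: $\chi(G)$ is the (proper) chromatic number of $G$. An $(A,B)$-bipartite graph is a bipartite graph whose vertex set is partitioned into independent sets $A$ and $B$. A proper odd coloring of a graph is a proper vertex coloring in which, for every non-isolated vertex, some color appears an odd number of times among its neighbors. A proper conflict-free coloring is a proper vertex coloring in which, for every non-isolated vertex, some color appears exactly once among its neighbors. $\chi_{\mathrm{o}}(G)$ (resp. $\chi_{\mathrm{pcf}}(G)$) is the least positive integer $k$ such that $G$ has a proper odd (resp. proper conflict-free) coloring with $k$ colors. For a coloring $c$ and a vertex set $Z$, $c(Z)$ is the set of colors that $c$ uses on $Z$.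
   Formalization: The formal theorem assumes χ(G) ≥ 2 (G has an edge): for a non-empty edgeless graph and t = 2 the hypotheses hold and χ_o(G) = χ_pcf(G) = 1, but the stated bound is 0. Graphs are finite and simple. -}

module Defs where

open import Data.Bool using (true)
open import Data.Fin using (Fin; inject₁; finToFun; funToFin)
open import Data.Fin.Properties
  using (_≟_; any?; all?; inject₁-injective; finToFun-funToFin)
open import Data.Fin.Subset
  using (Subset; _∈_; _∩_; _∪_; ⊥; ⁅_⁆; ∣_∣; Nonempty)
open import Data.Fin.Subset.Properties
  using (_∈?_; nonempty?; x∈p∩q⁺; x∈p∩q⁻; x∈⁅x⁆; x∈⁅y⁆⇒x≡y; ⊆-antisym; ∣⁅x⁆∣≡1)
open import Data.Nat using (ℕ; zero; suc; parity; _≤_; _<_; z≤n; s≤s)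
import Data.Nat.Properties as ℕ
open import Data.Parity.Base using (1ℙ)
import Data.Parity.Properties as ℙ
open import Data.Product using (∃; _×_; _,_; proj₁; proj₂)
open import Data.Vec using (lookup; tabulate)
open import Data.Vec.Properties using (lookup⇒[]=; []=⇒lookup; lookup∘tabulate; tabulate-cong)
open import Function using (_∘_)
open import Level using (0ℓ)
open import Relation.Binary using (Rel; Symmetric; Irreflexive)
import Relation.Binary as B
open import Relation.Binary.PropositionalEquality
  using (_≡_; _≢_; _≗_; refl; sym; trans; cong; subst)
open import Relation.Nullary using (Dec; yes; no; does; ¬_; contradiction)
open import Relation.Nullary.Decidable
  using (_×-dec_; _→-dec_; ¬?; map′; dec-true)
open import Relation.Unary using (Pred; Decidable)

private
  variable
    n k : ℕ

subset : {P : Pred (Fin n) 0ℓ} → Decidable P → Subset n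
subset P? = tabulate (does ∘ P?)

∈-subset⁺ : {P : Pred (Fin n) 0ℓ} (P? : Decidable P) {x : Fin n} → P x → x ∈ subset P?
∈-subset⁺ P? {x} px =
  lookup⇒[]= x _ (trans (lookup∘tabulate (does ∘ P?) x) (dec-true (P? x) px))

∈-subset⁻ : {P : Pred (Fin n) 0ℓ} (P? : Decidable P) {x : Fin n} → x ∈ subset P? → P x
∈-subset⁻ P? {x} x∈ = go (P? x) (trans (sym (lookup∘tabulate (does ∘ P?) x)) ([]=⇒lookup x∈))
  where
  go : ∀ {A : Set} (d : Dec A) → does d ≡ true → A
  go (yes a) _ = a

-- A finite simple graph whose vertex set V is any subset of Fin n, so that an
-- induced subgraph is again a graph of the same type.  The elements of Fin n
-- outside V are not vertices; Adj never relates them to anything.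
record Graph (n : ℕ) : Set₁ where
  field
    V          : Subset n
    Adj        : Rel (Fin n) 0ℓ
    Adj?       : B.Decidable Adj
    Adj-sym    : Symmetric Adj
    Adj-irrefl : Irreflexive _≡_ Adj
    Adj⇒∈V     : ∀ {u v} → Adj u v → u ∈ V

open Graph public

_[_] : Graph n → Subset n → Graph n
G [ S ] = record
  { V          = V G ∩ S
  ; Adj        = λ u v → u ∈ S × v ∈ S × Adj G u v
  ; Adj?       = λ u v → (u ∈? S) ×-dec (v ∈? S) ×-dec Adj? G u v
  ; Adj-sym    = λ (u∈ , v∈ , uv) → v∈ , u∈ , Adj-sym G uv
  ; Adj-irrefl = λ eq (_ , _ , uv) → Adj-irrefl G eq uv
  ; Adj⇒∈V     = λ (u∈ , _ , uv) → x∈p∩q⁺ (Adj⇒∈V G uv , u∈)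
  }

N : Graph n → Fin n → Subset n
N G v = subset (Adj? G v)

Independent : Graph n → Subset n → Set
Independent G Z = ∀ {u v} → u ∈ Z → v ∈ Z → ¬ Adj G u v

record IsBipartition (G : Graph n) (A B : Subset n) : Set where
  field
    cover        : A ∪ B ≡ V G
    disjoint     : A ∩ B ≡ ⊥
    independentˡ : Independent G A
    independentʳ : Independent G B

-- Not every colour need be used.  Values off V G are junk: the properties
-- below only inspect the colours of endpoints of edges.
Coloring : ℕ → ℕ → Set
Coloring n k = Fin n → Fin k

colorClass : Coloring n k → Fin k → Subset n
colorClass c α = subset (λ u → c u ≟ α)

colorsOn : Coloring n k → Subset n → Subset k
colorsOn c Z = subset (λ α → any? (λ u → (u ∈? Z) ×-dec (c u ≟ α)))

multiplicity : Graph n → Coloring n k → Fin n → Fin k → ℕ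
multiplicity G c v α = ∣ N G v ∩ colorClass c α ∣

ColoringProperty : Set₁
ColoringProperty = ∀ {n k} → Graph n → Coloring n k → Set

Proper : ColoringProperty
Proper G c = ∀ u v → Adj G u v → c u ≢ c v

-- Nonempty (N G v) says that v is a non-isolated vertex.
ProperOdd : ColoringProperty
ProperOdd G c =
  Proper G c × (∀ v → Nonempty (N G v) → ∃ λ α → parity (multiplicity G c v α) ≡ 1ℙ)

ProperConflictFree : ColoringProperty
ProperConflictFree G c =
  Proper G c × (∀ v → Nonempty (N G v) → ∃ λ α → multiplicity G c v α ≡ 1)

ColorableWith : ColoringProperty → Graph n → ℕ → Set
ColorableWith {n} P G k = ∃ λ (c : Coloring n k) → P G c

record IsLeastPositive (P : ℕ → Set) (k : ℕ) : Set where
  field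
    positive : 0 < k
    holds    : P k
    minimal  : ∀ j → 0 < j → P j → k ≤ j

-- The rest shows that the least positive k exists for each kind of colouring:
-- k-colourability is decidable, and giving each of the n vertices its own
-- colour among n + 1 colours is always a proper conflict-free colouring.

leastPositive : {P : ℕ → Set} → Decidable P → ∀ b → P (suc b) → ∃ (IsLeastPositive P)
leastPositive P? zero    p = 1 , record { positive = s≤s z≤n ; holds = p ; minimal = λ _ 0<j _ → 0<j }
leastPositive P? (suc b) p with P? 1
... | yes p₁ = 1 , record { positive = s≤s z≤n ; holds = p₁ ; minimal = λ _ 0<j _ → 0<j }
... | no ¬p₁ with leastPositive (P? ∘ suc) b p
...   | m , l = suc m , record { positive = s≤s z≤n ; holds = IsLeastPositive.holds l ; minimal = min }
  where
  min : ∀ j → 0 < j → _ → suc m ≤ j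
  min (suc zero)    _ q = contradiction q ¬p₁
  min (suc (suc j)) _ q = s≤s (IsLeastPositive.minimal l (suc j) (s≤s z≤n) q)

record Searchable (P : ColoringProperty) : Set₁ where
  field
    decide : (G : Graph n) (c : Coloring n k) → Dec (P G c)
    resp   : (G : Graph n) {c d : Coloring n k} → c ≗ d → P G c → P G d
    exists : (G : Graph n) → P G (inject₁ {n})

colorableWith? : {P : ColoringProperty} → Searchable P →
                 (G : Graph n) → Decidable (ColorableWith P G)
colorableWith? {n} {P} s G k =
  map′ (λ (i , p) → finToFun i , p)
       (λ (c , p) → funToFin c , resp G (sym ∘ finToFun-funToFin c) p)
       (any? (λ i → decide G (finToFun {k} {n} i)))
  where open Searchable s

leastColors : (P : ColoringProperty) → Searchable P →
              (G : Graph n) → ∃ (IsLeastPositive (ColorableWith P G))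
leastColors {n} P s G =
  leastPositive (colorableWith? {P = P} s G) n (inject₁ , Searchable.exists s G)

multiplicity-cong : (G : Graph n) {c d : Coloring n k} → c ≗ d →
                    ∀ v α → multiplicity G c v α ≡ multiplicity G d v α
multiplicity-cong G c≗d v α =
  cong (λ Z → ∣ N G v ∩ Z ∣) (tabulate-cong (λ u → cong (λ β → does (β ≟ α)) (c≗d u)))

proper? : (G : Graph n) (c : Coloring n k) → Dec (Proper G c)
proper? G c = all? λ u → all? λ v → Adj? G u v →-dec ¬? (c u ≟ c v)

Proper-resp : (G : Graph n) {c d : Coloring n k} → c ≗ d → Proper G c → Proper G d
Proper-resp G c≗d p u v uv du≡dv = p u v uv (trans (c≗d u) (trans du≡dv (sym (c≗d v))))

inject₁-proper : (G : Graph n) → Proper G (inject₁ {n})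
inject₁-proper G u v uv eq = Adj-irrefl G (inject₁-injective eq) uv

inject₁-multiplicity : (G : Graph n) {v u : Fin n} → u ∈ N G v →
                       multiplicity G inject₁ v (inject₁ u) ≡ 1
inject₁-multiplicity G {v} {u} u∈ = trans (cong ∣_∣ (⊆-antisym to from)) (∣⁅x⁆∣≡1 u)
  where
  class? = λ w → inject₁ w ≟ inject₁ u
  to : ∀ {w} → w ∈ N G v ∩ colorClass inject₁ (inject₁ u) → w ∈ ⁅ u ⁆
  to w∈ = subst (_∈ ⁅ u ⁆)
                (sym (inject₁-injective (∈-subset⁻ class? (proj₂ (x∈p∩q⁻ (N G v) _ w∈)))))
                (x∈⁅x⁆ u)
  from : ∀ {w} → w ∈ ⁅ u ⁆ → w ∈ N G v ∩ colorClass inject₁ (inject₁ u)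
  from w∈ with refl ← x∈⁅y⁆⇒x≡y u w∈ = x∈p∩q⁺ (u∈ , ∈-subset⁺ class? refl)

proper-searchable : Searchable Proper
proper-searchable = record
  { decide = proper? ; resp = Proper-resp ; exists = inject₁-proper }

properOdd-searchable : Searchable ProperOdd
properOdd-searchable = record
  { decide = λ G c → proper? G c ×-dec
      all? λ v → nonempty? (N G v) →-dec any? λ α → parity (multiplicity G c v α) ℙ.≟ 1ℙ
  ; resp   = λ G c≗d (p , o) → Proper-resp G c≗d p , λ v ne →
      let α , eq = o v ne
      in  α , trans (cong parity (sym (multiplicity-cong G c≗d v α))) eq
  ; exists = λ G → inject₁-proper G , λ v (u , u∈) →
      inject₁ u , cong parity (inject₁-multiplicity G u∈)
  }

properConflictFree-searchable : Searchable ProperConflictFree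
properConflictFree-searchable = record
  { decide = λ G c → proper? G c ×-dec
      all? λ v → nonempty? (N G v) →-dec any? λ α → multiplicity G c v α ℕ.≟ 1
  ; resp   = λ G c≗d (p , o) → Proper-resp G c≗d p , λ v ne →
      let α , eq = o v ne
      in  α , trans (sym (multiplicity-cong G c≗d v α)) eq
  ; exists = λ G → inject₁-proper G , λ v (u , u∈) →
      inject₁ u , inject₁-multiplicity G u∈
  }

-- With "least positive", χ is 1 rather than 0 on the graph with no vertices;
-- on every other graph this is the usual chromatic number.
χ χo χpcf : Graph n → ℕ
χ  G = proj₁ (leastColors Proper proper-searchable G)
χo G = proj₁ (leastColors ProperOdd properOdd-searchable G)
χpcf G = proj₁ (leastColors ProperConflictFree properConflictFree-searchable G)

{-# OPTIONS --safe #-}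

-- Order the colour classes V₀, …, Vₖ₋₁ of a proper colouring as a path.  A
-- non-isolated vertex with no neighbour in the classes next to its own can be
-- moved next to the class of one of its neighbours; it had no neighbour in a
-- consecutive class, so this spoils no other vertex.  Hence we may assume that
-- every non-isolated vertex has a neighbour in a consecutive class.  Colour
-- v ∈ Vᵢ by i and its colours in the given colourings of G[Vᵢ₋₁ ∪ Vᵢ] and
-- G[Vᵢ ∪ Vᵢ₊₁]: the two end classes use t colours each, the others t².  The
-- neighbours of v with a given colour in such a bipartite subgraph are thereby
-- split into new colour classes, and one part of a sum that is odd (or 1) is
-- again odd (or 1).

module Submission where

open import Defs
open import Data.Empty using (⊥-elim)
open import Data.Fin using (Fin; zero; suc; inject₁)
open import Data.Fin.Properties using (_≟_; any?; +↔⊎; *↔×; suc-injective)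
open import Data.Fin.Relation.Unary.Top using (View; ‵fromℕ; ‵inj₁; view; view-inject₁)
open import Data.Fin.Subset
  using (Subset; inside; outside; _∈_; _∩_; _∪_; ∁; ⊥; ⁅_⁆; ∣_∣; Nonempty)
open import Data.Fin.Subset.Properties
  using ( _∈?_; nonempty?; Empty-unique; ∣⊥∣≡0; ∉⊥; x∈⁅x⁆; x∈⁅y⁆⇒x≡y; p⊆q⇒∣p∣≤∣q∣; ∣⁅x⁆∣≡1; ⊆-antisym
        ; x∈p∩q⁺; x∈p∩q⁻; x∈p∪q⁺; x∈p∪q⁻; x∈∁p⇒x∉p; x∉p⇒x∈∁p; ∪-identityʳ; ∩-zeroʳ)
open import Data.Integer using (ℤ; +_; -[1+_]; _+_; _-_; _*_; _≤_; +≤+)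
import Data.Integer.Properties as ℤ
open import Data.Integer.Tactic.RingSolver using (solve-∀)
open import Data.List using ([]; _∷_; allFin)
open import Data.List.Membership.Propositional using () renaming (_∈_ to _∈ˡ_)
open import Data.List.Membership.Propositional.Properties using (∈-allFin)
open import Data.List.Relation.Unary.Any using (here; there)
open import Data.Nat as ℕ using (ℕ; zero; suc; parity; z≤n; s≤s)
import Data.Nat.Properties as ℕ
open import Data.Parity.Base using (0ℙ; 1ℙ)
import Data.Parity.Properties as ℙ
open import Data.Product using (∃; ∃₂; _×_; _,_; proj₁; proj₂; map₁; map₂)
open import Data.Product.Function.NonDependent.Propositional using (_×-↔_)
open import Data.Product.Properties using (,-injectiveˡ; ,-injectiveʳ)
open import Data.Sum using (_⊎_; inj₁; inj₂; [_,_]′)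
open import Data.Sum.Function.Propositional using (_⊎-↔_)
open import Data.Sum.Properties using (inj₁-injective; inj₂-injective)
open import Data.Vec using ([]; _∷_; here; there)
open import Data.Vec.Functional using (updateAt)
open import Data.Vec.Functional.Properties using (updateAt-updates; updateAt-minimal)
open import Function using (_∘_; const; id; _↔_; Injection)
open import Function.Properties.Inverse using (↔-refl; ↔-sym; ↔-trans; ↔⇒↣)
open import Level using (0ℓ)
open import Relation.Binary.PropositionalEquality
  using (_≡_; _≢_; refl; sym; trans; cong; subst)
open import Relation.Nullary using (Dec; yes; no; ¬_; contradiction)
open import Relation.Nullary.Decidable using (_×-dec_; _⊎-dec_)
open import Relation.Unary using (Pred; Decidable)

private
  variable
    n k m K T : ℕ

-- Predicates on multiplicities that survive splitting.

-- Captures what oddness and being equal to 1 have in common, so that both claims follow from one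
-- argument.
record Splitting (Q : Pred ℕ 0ℓ) : Set where
  field
    ¬0    : ¬ Q 0
    split : ∀ a {b} → Q (a ℕ.+ b) → Q a ⊎ Q b

odd-splitting : Splitting (λ a → parity a ≡ 1ℙ)
odd-splitting = record { ¬0 = λ () ; split = λ a {b} → go a b (parity a) refl }
  where
  go : ∀ a b p → parity a ≡ p → parity (a ℕ.+ b) ≡ 1ℙ → parity a ≡ 1ℙ ⊎ parity b ≡ 1ℙ
  go a b 1ℙ eq _ = inj₁ eq
  go a b 0ℙ eq o with h ← ℙ.+-homo-+ a b rewrite eq = inj₂ (trans (sym h) o)

one-splitting : Splitting (_≡ 1)
one-splitting = record { ¬0 = λ () ; split = split }
  where
  split : ∀ a {b} → a ℕ.+ b ≡ 1 → a ≡ 1 ⊎ b ≡ 1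
  split zero    eq = inj₂ eq
  split (suc a) eq = inj₁ (cong suc (ℕ.m+n≡0⇒m≡0 a (ℕ.suc-injective eq)))

∣p∣≡∣p∩q∣+∣p∩∁q∣ : (p q : Subset n) → ∣ p ∣ ≡ ∣ p ∩ q ∣ ℕ.+ ∣ p ∩ ∁ q ∣
∣p∣≡∣p∩q∣+∣p∩∁q∣ []            []            = refl
∣p∣≡∣p∩q∣+∣p∩∁q∣ (outside ∷ p) (_       ∷ q) = ∣p∣≡∣p∩q∣+∣p∩∁q∣ p q
∣p∣≡∣p∩q∣+∣p∩∁q∣ (inside  ∷ p) (inside  ∷ q) = cong suc (∣p∣≡∣p∩q∣+∣p∩∁q∣ p q)
∣p∣≡∣p∩q∣+∣p∩∁q∣ (inside  ∷ p) (outside ∷ q) =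
  trans (cong suc (∣p∣≡∣p∩q∣+∣p∩∁q∣ p q)) (sym (ℕ.+-suc _ _))

∈-colorClass⁺ : (c : Coloring n k) {α : Fin k} {u : Fin n} → c u ≡ α → u ∈ colorClass c α
∈-colorClass⁺ c {α} = ∈-subset⁺ (λ u → c u ≟ α)

∈-colorClass⁻ : (c : Coloring n k) {α : Fin k} {u : Fin n} → u ∈ colorClass c α → c u ≡ α
∈-colorClass⁻ c {α} = ∈-subset⁻ (λ u → c u ≟ α)

∈-N⁺ : (G : Graph n) {u v : Fin n} → Adj G v u → u ∈ N G v
∈-N⁺ G {v = v} = ∈-subset⁺ (Adj? G v)

∈-N⁻ : (G : Graph n) {u v : Fin n} → u ∈ N G v → Adj G v u
∈-N⁻ G {v = v} = ∈-subset⁻ (Adj? G v)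

∈-colorsOn⁺ : (c : Coloring n k) {Z : Subset n} {u : Fin n} → u ∈ Z → c u ∈ colorsOn c Z
∈-colorsOn⁺ c {Z} u∈ = ∈-subset⁺ (λ α → any? λ u → (u ∈? Z) ×-dec (c u ≟ α)) (_ , u∈ , refl)

module _ {Q : Pred ℕ 0ℓ} (Q-splitting : Splitting Q) where
  open Splitting Q-splitting

  Q⇒nonempty : (Z : Subset n) → Q ∣ Z ∣ → Nonempty Z
  Q⇒nonempty {n} Z q with nonempty? Z
  ... | yes ne = ne
  ... | no  e  = contradiction (subst Q (trans (cong ∣_∣ (Empty-unique e)) (∣⊥∣≡0 n)) q) ¬0

  -- Colors are removed one at a time: `split` puts `Q` either on the class just removed or on what
  -- remains. Since `¬0` makes the remainder nonempty, the search succeeds before the colors run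
  -- out.
  Q-colorClass : (f : Coloring n k) (Z : Subset n) → Q ∣ Z ∣ → ∃ λ β → Q ∣ Z ∩ colorClass f β ∣
  Q-colorClass {n} {k} f Z q = go (allFin k) Z (λ _ → ∈-allFin _) q
    where
    remaining : ∀ {β βs} (Z : Subset n) → (∀ {x} → x ∈ Z → f x ∈ˡ β ∷ βs) →
                ∀ {x} → x ∈ Z ∩ ∁ (colorClass f β) → f x ∈ˡ βs
    remaining Z f∈ x∈ with x∈Z , x∉β ← x∈p∩q⁻ Z _ x∈ with f∈ x∈Z
    ... | here eq = contradiction (∈-colorClass⁺ f eq) (x∈∁p⇒x∉p x∉β)
    ... | there l = l

    restrict : ∀ {β γ} (Z : Subset n) {x} →
               x ∈ (Z ∩ ∁ (colorClass f β)) ∩ colorClass f γ → x ∈ Z ∩ colorClass f γ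
    restrict Z x∈ with y∈ , x∈γ ← x∈p∩q⁻ (Z ∩ _) _ x∈ = x∈p∩q⁺ (proj₁ (x∈p∩q⁻ Z _ y∈) , x∈γ)

    unrestrict : ∀ {β γ} → γ ≢ β → (Z : Subset n) → ∀ {x} →
                 x ∈ Z ∩ colorClass f γ → x ∈ (Z ∩ ∁ (colorClass f β)) ∩ colorClass f γ
    unrestrict γ≢β Z x∈ with x∈Z , x∈γ ← x∈p∩q⁻ Z _ x∈ =
      x∈p∩q⁺ (x∈p∩q⁺ (x∈Z , x∉p⇒x∈∁p λ x∈β →
        γ≢β (trans (sym (∈-colorClass⁻ f x∈γ)) (∈-colorClass⁻ f x∈β))) , x∈γ)

    go : ∀ βs (Z : Subset n) → (∀ {x} → x ∈ Z → f x ∈ˡ βs) → Q ∣ Z ∣ →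
         ∃ λ β → Q ∣ Z ∩ colorClass f β ∣
    go [] Z f∈ q with () ← f∈ (proj₂ (Q⇒nonempty Z q))
    go (β ∷ βs) Z f∈ q
      with split ∣ Z ∩ colorClass f β ∣
                 (subst Q (∣p∣≡∣p∩q∣+∣p∩∁q∣ Z (colorClass f β)) q)
    ... | inj₁ q₁ = β , q₁
    ... | inj₂ q₂ with γ , qγ ← go βs (Z ∩ ∁ (colorClass f β)) (remaining Z f∈) q₂ =
      γ , subst (Q ∘ ∣_∣) (⊆-antisym (restrict Z) (unrestrict (γ≢β qγ) Z)) qγ
      where
      -- The class of `β` has left the remainder, while `Q` forces the class of `γ` to meet it.
      -- Hence the `γ` class has the same elements in the remainder as in `Z`.
      γ≢β : ∀ {γ} → Q ∣ (Z ∩ ∁ (colorClass f β)) ∩ colorClass f γ ∣ → γ ≢ β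
      γ≢β qγ refl with x , x∈ ← Q⇒nonempty _ qγ with y∈ , x∈γ ← x∈p∩q⁻ (Z ∩ _) _ x∈ =
        x∈∁p⇒x∉p (proj₂ (x∈p∩q⁻ Z _ y∈)) x∈γ

  -- A `d` class satisfying `Q` is found inside the `p` class of `α` in `N H v`. By the second
  -- condition, no further neighbor of `v` in `G` has that `d` color, so the count is the full
  -- multiplicity in `G`.
  Q-refine : (G H : Graph n) (p : Coloring n k) (d : Coloring n K) (v : Fin n) →
             (∀ {x} → Adj H v x → Adj G v x) →
             (∀ {x w} → Adj H v w → Adj G v x → d x ≡ d w → Adj H v x × p x ≡ p w) →
             ∀ {α} → Q (multiplicity H p v α) → ∃ λ β → Q (multiplicity G d v β)
  Q-refine G H p d v H⊆G closed {α} q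
    with β , qβ ← Q-colorClass d (N H v ∩ colorClass p α) q
    with w , w∈ ← Q⇒nonempty _ qβ
    with w∈Z , w∈β ← x∈p∩q⁻ (N H v ∩ _) _ w∈
    with w∈N , w∈α ← x∈p∩q⁻ (N H v) _ w∈Z
    = β , subst (Q ∘ ∣_∣) (⊆-antisym to from) qβ
    where
    to : ∀ {x} → x ∈ (N H v ∩ colorClass p α) ∩ colorClass d β → x ∈ N G v ∩ colorClass d β
    to x∈ with x∈Z , x∈β ← x∈p∩q⁻ (N H v ∩ _) _ x∈ =
      x∈p∩q⁺ (∈-N⁺ G (H⊆G (∈-N⁻ H (proj₁ (x∈p∩q⁻ (N H v) _ x∈Z)))) , x∈β)
    from : ∀ {x} → x ∈ N G v ∩ colorClass d β → x ∈ (N H v ∩ colorClass p α) ∩ colorClass d β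
    from x∈ with x∈N , x∈β ← x∈p∩q⁻ (N G v) _ x∈
            with vx , px≡pw ← closed (∈-N⁻ H w∈N) (∈-N⁻ G x∈N)
                                (trans (∈-colorClass⁻ d x∈β) (sym (∈-colorClass⁻ d w∈β)))
      = x∈p∩q⁺ (x∈p∩q⁺ (∈-N⁺ H vx , ∈-colorClass⁺ p (trans px≡pw (∈-colorClass⁻ p w∈α))) , x∈β)

-- Recoloring so that neighbors lie in consecutive classes.

Consecutive : Fin (suc k) → Fin (suc k) → Set
Consecutive i j = ∃ λ l → (i ≡ inject₁ l × j ≡ suc l) ⊎ (i ≡ suc l × j ≡ inject₁ l)

consecutive? : (i j : Fin (suc k)) → Dec (Consecutive i j)
consecutive? i j = any? λ l →
  ((i ≟ inject₁ l) ×-dec (j ≟ suc l)) ⊎-dec ((i ≟ suc l) ×-dec (j ≟ inject₁ l))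

Consecutive-sym : {i j : Fin (suc k)} → Consecutive i j → Consecutive j i
Consecutive-sym (l , inj₁ (p , q)) = l , inj₂ (q , p)
Consecutive-sym (l , inj₂ (p , q)) = l , inj₁ (q , p)

Consecutive-suc : {i j : Fin (suc k)} → Consecutive i j → Consecutive (suc i) (suc j)
Consecutive-suc (l , inj₁ (refl , refl)) = suc l , inj₁ (refl , refl)
Consecutive-suc (l , inj₂ (refl , refl)) = suc l , inj₂ (refl , refl)

-- A discrete intermediate value argument: walking from an index where `P` fails to one where it
-- holds, `P` must change between two consecutive indices.
boundary : {P : Pred (Fin (suc k)) 0ℓ} → Decidable P → ∀ {i j} → ¬ P i → P j →
           ∃₂ λ i′ j′ → Consecutive i′ j′ × ¬ P i′ × P j′
boundary {zero}  P? {zero}  {zero}  ¬p p = contradiction p ¬p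
boundary {suc k} {P} P? {i} {j} ¬p p with P? zero | P? (suc zero)
... | yes p₀ | no ¬p₁ = suc zero , zero , (zero , inj₂ (refl , refl)) , ¬p₁ , p₀
... | no ¬p₀ | yes p₁ = zero , suc zero , (zero , inj₁ (refl , refl)) , ¬p₀ , p₁
... | yes p₀ | yes p₁ = tail i ¬p
  where
  tail : ∀ i → ¬ P i → ∃₂ λ i′ j′ → Consecutive i′ j′ × ¬ P i′ × P j′
  tail zero    ¬p = contradiction p₀ ¬p
  tail (suc i) ¬p with i′ , j′ , cons , r ← boundary (P? ∘ suc) ¬p p₁ =
    suc i′ , suc j′ , Consecutive-suc cons , r
... | no ¬p₀ | no ¬p₁ = tail j p
  where
  tail : ∀ j → P j → ∃₂ λ i′ j′ → Consecutive i′ j′ × ¬ P i′ × P j′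
  tail zero    p = contradiction p ¬p₀
  tail (suc j) p with i′ , j′ , cons , r ← boundary (P? ∘ suc) ¬p₁ p =
    suc i′ , suc j′ , Consecutive-suc cons , r

HasConsecutiveNeighbor : Graph n → Coloring n (suc k) → Fin n → Set
HasConsecutiveNeighbor G φ v = ∃ λ w → Adj G v w × Consecutive (φ v) (φ w)

recolor-vertex : (G : Graph n) (φ : Coloring n (suc k)) → Proper G φ →
                 ∀ v → Nonempty (N G v) →
                 ∃ λ ψ → Proper G ψ × HasConsecutiveNeighbor G ψ v ×
                   (∀ u → HasConsecutiveNeighbor G φ u → HasConsecutiveNeighbor G ψ u)
recolor-vertex {n} {k} G φ proper v (x , x∈)
  with any? (λ w → Adj? G v w ×-dec consecutive? (φ v) (φ w))
... | yes good = φ , proper , good , λ _ → id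
... | no ¬good
  -- Apply `boundary` to the set of colors seen by `v`: it misses `φ v` by properness and contains
  -- `φ x`. The resulting `i` is unseen by `v` but consecutive to the seen color `φ w`.
  with i , _ , cons , free , w , vw , refl ←
         boundary (λ i → any? (λ w → Adj? G v w ×-dec (φ w ≟ i)))
           {φ v} {φ x} (λ (w , vw , eq) → proper v w vw (sym eq)) (x , ∈-N⁻ G x∈ , refl)
  = ψ , ψ-proper , (w , vw , consecutive-ψ) , λ u → keep u
  where
  ψ : Coloring n (suc k)
  ψ = updateAt φ v (const i)
  ψv : ψ v ≡ i
  ψv = updateAt-updates v φ
  ψ-other : ∀ {u} → u ≢ v → ψ u ≡ φ u
  ψ-other = updateAt-minimal _ v φ
  adj-≢ : ∀ {u} → Adj G v u → u ≢ v
  adj-≢ vu eq = Adj-irrefl G (sym eq) vu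
  consecutive-ψ : Consecutive (ψ v) (ψ w)
  consecutive-ψ rewrite ψv | ψ-other (adj-≢ vw) = cons
  new-color : ∀ {u} → Adj G v u → ψ v ≢ ψ u
  new-color vu eq = free (_ , vu , trans (sym (ψ-other (adj-≢ vu))) (trans (sym eq) ψv))
  ψ-proper : Proper G ψ
  ψ-proper a b ab with a ≟ v | b ≟ v
  ... | yes refl | _        = new-color ab
  ... | no _     | yes refl = new-color (Adj-sym G ab) ∘ sym
  ... | no a≢v   | no b≢v   = λ eq → proper a b ab (trans (sym (ψ-other a≢v)) (trans eq (ψ-other b≢v)))
  keep : ∀ u → HasConsecutiveNeighbor G φ u → HasConsecutiveNeighbor G ψ u
  keep u (y , uy , c) with u ≟ v | y ≟ v
  -- A consecutive pair involving `v` would contradict `¬good`, so every consecutive neighbor pair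
  -- avoids `v` and keeps its colors.
  ... | yes refl | _        = contradiction (y , uy , c) ¬good
  ... | no _     | yes refl = contradiction (u , Adj-sym G uy , Consecutive-sym c) ¬good
  ... | no u≢v   | no y≢v   = y , uy , c′
    where
    c′ : Consecutive (ψ u) (ψ y)
    c′ rewrite ψ-other u≢v | ψ-other y≢v = c

-- The vertices are treated one after another; `recolor-vertex` never spoils those already treated.
recolor : (G : Graph n) (φ : Coloring n (suc k)) → Proper G φ →
          ∃ λ ψ → Proper G ψ × (∀ v → Nonempty (N G v) → HasConsecutiveNeighbor G ψ v)
recolor {n} {k} G φ proper = map₂ (map₂ λ good v → good (∈-allFin v)) (go (allFin n))
  where
  go : ∀ vs → ∃ λ (ψ : Coloring n (suc k)) → Proper G ψ ×
         (∀ {v} → v ∈ˡ vs → Nonempty (N G v) → HasConsecutiveNeighbor G ψ v)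
  go [] = φ , proper , λ ()
  go (v ∷ vs) with ψ , ψ-proper , good ← go vs | nonempty? (N G v)
  ... | no isolated = ψ , ψ-proper , λ where
          (here refl) ne → contradiction ne isolated
          (there u∈)  ne → good u∈ ne
  ... | yes ne with θ , θ-proper , good-v , keep ← recolor-vertex G ψ ψ-proper v ne =
          θ , θ-proper , λ where
          (here refl) _  → good-v
          (there u∈)  ne → keep _ (good u∈ ne)

-- Encoding the colors along the path.

-- Renames the colors used on one side of a layer into a palette of fixed size. The palette is
-- nonempty so that colors outside `P` also have a value.
compress : (P : Subset k) → ∣ P ∣ ℕ.≤ suc T →
           ∃ λ (r : Fin k → Fin (suc T)) → ∀ {x y} → x ∈ P → y ∈ P → r x ≡ r y → x ≡ y
compress [] _ = (λ ()) , λ ()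
compress {suc k} {T} (outside ∷ P) le with r , inj ← compress P le = r′ , inj′
  where
  r′ : Fin (suc k) → Fin (suc T)
  r′ zero    = zero
  r′ (suc x) = r x
  inj′ : ∀ {x y} → x ∈ outside ∷ P → y ∈ outside ∷ P → r′ x ≡ r′ y → x ≡ y
  inj′ (there x∈) (there y∈) eq = cong suc (inj x∈ y∈ eq)
-- The single available color is taken by the head, so the tail must be empty and a constant map is
-- injective on the set.
compress {suc k} {zero} (inside ∷ P) (s≤s le) = const zero , inj
  where
  tail-empty : ∀ {x} → ¬ x ∈ P
  tail-empty {x} x∈ with () ← ℕ.≤-trans (ℕ.≤-reflexive (sym (∣⁅x⁆∣≡1 x)))
    (ℕ.≤-trans (p⊆q⇒∣p∣≤∣q∣ (λ y∈ → subst (_∈ P) (sym (x∈⁅y⁆⇒x≡y x y∈)) x∈)) le)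
  inj : ∀ {x y} → x ∈ inside ∷ P → y ∈ inside ∷ P → zero ≡ zero → x ≡ y
  inj here       here       _ = refl
  inj here       (there y∈) _ = contradiction y∈ tail-empty
  inj (there x∈) _          _ = contradiction x∈ tail-empty
compress {suc k} {suc T} (inside ∷ P) (s≤s le) with r , inj ← compress P le = r′ , inj′
  where
  r′ : Fin (suc k) → Fin (suc (suc T))
  r′ zero    = zero
  r′ (suc x) = suc (r x)
  inj′ : ∀ {x y} → x ∈ inside ∷ P → y ∈ inside ∷ P → r′ x ≡ r′ y → x ≡ y
  inj′ here       here       _  = refl
  inj′ (there x∈) (there y∈) eq = cong suc (inj x∈ y∈ (suc-injective eq))

-- `a l` and `b l` stand for the colors that layer `l` gives to its first class `inject₁ l` and its
-- second class `suc l`.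
module PathCode {X : Set} (T m : ℕ) (a b : Fin (suc m) → X → Fin T) where

  -- The summands are the first class, the last class and the m classes between.
  Code : Set
  Code = Fin T ⊎ (Fin T ⊎ (Fin m × Fin T × Fin T))

  -- Codes class `suc i`. The last class lies in layer `i` only; an inner class is also the first
  -- class of the next layer, whence the pair of colors.
  later : {i : Fin (suc m)} → View i → X → Code
  later {i} ‵fromℕ           x = inj₂ (inj₁ (b i x))
  later {i} (‵inj₁ {i = j} _) x = inj₂ (inj₂ (j , b i x , a (suc j) x))

  code : Fin (suc (suc m)) → X → Code
  code zero    x = inj₁ (a zero x)
  code (suc i) x = later (view i) x

  later-class : ∀ {i j} (p : View i) (q : View j) {x y} → later p x ≡ later q y → i ≡ j
  later-class ‵fromℕ    ‵fromℕ    _    = refl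
  later-class (‵inj₁ _) (‵inj₁ _) eq   =
    cong inject₁ (,-injectiveˡ (inj₂-injective (inj₂-injective eq)))
  later-class ‵fromℕ    (‵inj₁ _) ()
  later-class (‵inj₁ _) ‵fromℕ    ()

  code-class : ∀ i j {x y} → code i x ≡ code j y → i ≡ j
  code-class zero    zero    _  = refl
  code-class zero    (suc j) eq with view j
  code-class zero    (suc j) () | ‵fromℕ
  code-class zero    (suc j) () | ‵inj₁ _
  code-class (suc i) zero    eq with view i
  code-class (suc i) zero    () | ‵fromℕ
  code-class (suc i) zero    () | ‵inj₁ _
  code-class (suc i) (suc j) eq = cong suc (later-class (view i) (view j) eq)

  code-inject₁ : ∀ l {x y} → code (inject₁ l) x ≡ code (inject₁ l) y → a l x ≡ a l y
  code-inject₁ zero    eq = inj₁-injective eq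
  code-inject₁ (suc l) eq rewrite view-inject₁ l =
    ,-injectiveʳ (,-injectiveʳ (inj₂-injective (inj₂-injective eq)))

  code-suc : ∀ l {x y} → code (suc l) x ≡ code (suc l) y → b l x ≡ b l y
  code-suc l eq with view l
  ... | ‵fromℕ  = inj₁-injective (inj₂-injective eq)
  ... | ‵inj₁ _ = ,-injectiveˡ (,-injectiveʳ (inj₂-injective (inj₂-injective eq)))

  Code↔Fin : Code ↔ Fin (T ℕ.+ (T ℕ.+ m ℕ.* (T ℕ.* T)))
  Code↔Fin =
    ↔-sym (↔-trans +↔⊎ (↔-refl ⊎-↔ ↔-trans +↔⊎ (↔-refl ⊎-↔ ↔-trans *↔× (↔-refl ×-↔ *↔×))))

-- The coloring built from the layers.

-- Unfolds to `ProperOdd` or to `ProperConflictFree` for the two choices of `Q`, so both are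
-- instances by computation.
Satisfying : Pred ℕ 0ℓ → ColoringProperty
Satisfying Q G c =
  Proper G c × (∀ v → Nonempty (N G v) → ∃ λ α → Q (multiplicity G c v α))

BipartiteColorable : Pred ℕ 0ℓ → Graph n → ℕ → Set
BipartiteColorable {n} Q G T =
  ∀ (S A B : Subset n) → IsBipartition (G [ S ]) A B →
    ∃₂ λ (k : ℕ) (c : Coloring n k) →
      Satisfying Q (G [ S ]) c × ∣ colorsOn c A ∣ ℕ.≤ T × ∣ colorsOn c B ∣ ℕ.≤ T

module PathColoring {Q : Pred ℕ 0ℓ} (Q-splitting : Splitting Q)
  (G : Graph n) (φ : Coloring n (suc (suc m))) (φ-proper : Proper G φ)
  (φ-good : ∀ v → Nonempty (N G v) → HasConsecutiveNeighbor G φ v)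
  (hyp : BipartiteColorable Q G (suc T))
  where

  class : Fin (suc (suc m)) → Subset n
  class i = V G ∩ colorClass φ i

  ∈-class⁺ : ∀ {i u} → u ∈ V G → φ u ≡ i → u ∈ class i
  ∈-class⁺ u∈ eq = x∈p∩q⁺ (u∈ , ∈-colorClass⁺ φ eq)

  ∈-class⁻ : ∀ {i u} → u ∈ class i → u ∈ V G × φ u ≡ i
  ∈-class⁻ u∈ = map₂ (∈-colorClass⁻ φ) (x∈p∩q⁻ (V G) _ u∈)

  class-independent : ∀ {i u v} → u ∈ class i → v ∈ class i → ¬ Adj G u v
  class-independent u∈ v∈ uv =
    φ-proper _ _ uv (trans (proj₂ (∈-class⁻ u∈)) (sym (proj₂ (∈-class⁻ v∈))))

  layer : Fin (suc m) → Subset n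
  layer l = class (inject₁ l) ∪ class (suc l)

  inject₁≢suc : ∀ {j} (l : Fin j) → inject₁ l ≢ suc l
  inject₁≢suc (suc l) eq = inject₁≢suc l (suc-injective eq)

  layer-bipartition : ∀ l → IsBipartition (G [ layer l ]) (class (inject₁ l)) (class (suc l))
  layer-bipartition l = record
    { cover        = ⊆-antisym (λ x∈ → x∈p∩q⁺ (layer⊆V x∈ , x∈)) (proj₂ ∘ x∈p∩q⁻ (V G) _)
    ; disjoint     = Empty-unique λ (x , x∈) → let a , b = x∈p∩q⁻ (class (inject₁ l)) _ x∈ in
        inject₁≢suc l (trans (sym (proj₂ (∈-class⁻ a))) (proj₂ (∈-class⁻ b)))
    ; independentˡ = λ u∈ v∈ (_ , _ , uv) → class-independent u∈ v∈ uv
    ; independentʳ = λ u∈ v∈ (_ , _ , uv) → class-independent u∈ v∈ uv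
    }
    where
    layer⊆V : ∀ {x} → x ∈ layer l → x ∈ V G
    layer⊆V x∈ = [ proj₁ ∘ ∈-class⁻ , proj₁ ∘ ∈-class⁻ ]′ (x∈p∪q⁻ (class (inject₁ l)) _ x∈)

  module Layer (l : Fin (suc m)) where
    layer-colorable = hyp (layer l) _ _ (layer-bipartition l)
    p : Coloring n (proj₁ layer-colorable)
    p = proj₁ (proj₂ layer-colorable)
    satisfying : Satisfying Q (G [ layer l ]) p
    satisfying = proj₁ (proj₂ (proj₂ layer-colorable))
    left  = compress (colorsOn p (class (inject₁ l))) (proj₁ (proj₂ (proj₂ (proj₂ layer-colorable))))
    right = compress (colorsOn p (class (suc l))) (proj₂ (proj₂ (proj₂ (proj₂ layer-colorable))))

    a b : Fin n → Fin (suc T)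
    a = proj₁ left ∘ p
    b = proj₁ right ∘ p

    a-injective : ∀ {x y} → x ∈ class (inject₁ l) → y ∈ class (inject₁ l) → a x ≡ a y → p x ≡ p y
    a-injective x∈ y∈ = proj₂ left (∈-colorsOn⁺ p x∈) (∈-colorsOn⁺ p y∈)

    b-injective : ∀ {x y} → x ∈ class (suc l) → y ∈ class (suc l) → b x ≡ b y → p x ≡ p y
    b-injective x∈ y∈ = proj₂ right (∈-colorsOn⁺ p x∈) (∈-colorsOn⁺ p y∈)

  open PathCode (suc T) m Layer.a Layer.b

  color : Coloring n _
  color u = Injection.to (↔⇒↣ Code↔Fin) (code (φ u) u)

  color-code : ∀ {x y} → color x ≡ color y → code (φ x) x ≡ code (φ y) y
  color-code = Injection.injective (↔⇒↣ Code↔Fin)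

  color-class : ∀ {x y} → color x ≡ color y → φ x ≡ φ y
  color-class eq = code-class _ _ (color-code eq)

  -- Equal colors force equal classes, so both codes can be taken at one index `i`, as
  -- `code-inject₁` and `code-suc` require.
  color-code-at : ∀ {i x w} → φ w ≡ i → color x ≡ color w → code i x ≡ code i w
  color-code-at {x = x} {w} refl eq =
    subst (λ i → code i x ≡ code (φ w) w) (color-class eq) (color-code eq)

  -- This is the closure condition of `Q-refine`: the new color records the class, and within it the
  -- color from each layer containing that class.
  color-layer : ∀ l {x w} → w ∈ layer l → x ∈ V G → color x ≡ color w →
                x ∈ layer l × Layer.p l x ≡ Layer.p l w
  color-layer l w∈ x∈V eq with x∈p∪q⁻ (class (inject₁ l)) _ w∈
  ... | inj₁ w∈A = x∈p∪q⁺ (inj₁ x∈A) ,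
                   Layer.a-injective l x∈A w∈A (code-inject₁ l (color-code-at φw eq))
    where
    φw = proj₂ (∈-class⁻ w∈A)
    x∈A = ∈-class⁺ x∈V (trans (color-class eq) φw)
  ... | inj₂ w∈B = x∈p∪q⁺ (inj₂ x∈B) ,
                   Layer.b-injective l x∈B w∈B (code-suc l (color-code-at φw eq))
    where
    φw = proj₂ (∈-class⁻ w∈B)
    x∈B = ∈-class⁺ x∈V (trans (color-class eq) φw)

  consecutive-layer : ∀ {u v} → u ∈ V G → v ∈ V G → Consecutive (φ u) (φ v) →
                      ∃ λ l → u ∈ layer l × v ∈ layer l
  consecutive-layer u∈ v∈ (l , inj₁ (φu , φv)) =
    l , x∈p∪q⁺ (inj₁ (∈-class⁺ u∈ φu)) , x∈p∪q⁺ (inj₂ (∈-class⁺ v∈ φv))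
  consecutive-layer u∈ v∈ (l , inj₂ (φu , φv)) =
    l , x∈p∪q⁺ (inj₂ (∈-class⁺ u∈ φu)) , x∈p∪q⁺ (inj₁ (∈-class⁺ v∈ φv))

  color-satisfying : Satisfying Q G color
  color-satisfying = (λ u v uv eq → φ-proper u v uv (color-class eq)) , at
    where
    at : ∀ v → Nonempty (N G v) → ∃ λ β → Q (multiplicity G color v β)
    at v ne
      with w , vw , cons ← φ-good v ne
      with l , v∈ , w∈ ← consecutive-layer (Adj⇒∈V G vw) (Adj⇒∈V G (Adj-sym G vw)) cons
      -- The neighbor `w` makes `v` non-isolated in layer `l`, so the given coloring of that layer
      -- provides a color at `v`.
      with α , q ← proj₂ (Layer.satisfying l) v (w , ∈-N⁺ (G [ layer l ]) (v∈ , w∈ , vw))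
      = Q-refine Q-splitting G (G [ layer l ]) (Layer.p l) color v
          (λ (_ , _ , vx) → vx)
          (λ (_ , y∈ , _) vx eq →
             map₁ (λ x∈ → v∈ , x∈ , vx) (color-layer l y∈ (Adj⇒∈V G (Adj-sym G vx)) eq))
          q

colorable : {Q : Pred ℕ 0ℓ} → Splitting Q → (G : Graph n) →
            ColorableWith Proper G (suc (suc m)) → BipartiteColorable Q G (suc T) →
            ColorableWith (Satisfying Q) G (suc T ℕ.+ (suc T ℕ.+ m ℕ.* (suc T ℕ.* suc T)))
colorable Q-splitting G (φ , φ-proper) hyp
  with ψ , ψ-proper , good ← recolor G φ φ-proper =
  color , color-satisfying
  where open PathColoring Q-splitting G ψ ψ-proper good hyp

-- The bound over the integers.

-- A one-vertex test subgraph: its side `V G ∩ ⁅ u ⁆` uses a color whenever `u` is a vertex, which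
-- forces `t` to be at least 1.
singleton-bipartition : (G : Graph n) (u : Fin n) → IsBipartition (G [ ⁅ u ⁆ ]) (V G ∩ ⁅ u ⁆) ⊥
singleton-bipartition G u = record
  { cover        = ∪-identityʳ _
  ; disjoint     = ∩-zeroʳ _
  ; independentˡ = λ _ _ (a∈ , b∈ , ab) →
      Adj-irrefl G (trans (x∈⁅y⁆⇒x≡y u a∈) (sym (x∈⁅y⁆⇒x≡y u b∈))) ab
  ; independentʳ = λ a∈ → contradiction a∈ ∉⊥
  }

nonempty⇒0<∣p∣ : {p : Subset n} → Nonempty p → 0 ℕ.< ∣ p ∣
nonempty⇒0<∣p∣                   (_ , here)     = s≤s z≤n
nonempty⇒0<∣p∣ {p = inside  ∷ _} (_ , there x∈) = s≤s z≤n
nonempty⇒0<∣p∣ {p = outside ∷ _} (_ , there x∈) = nonempty⇒0<∣p∣ (_ , x∈)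

-- With `k` inner classes, two end classes of `t` colors and `k` classes of `t * t` colors give the
-- claimed bound for `k + 2` classes.
bound-identity : ∀ t k → t + (t + k * (t * t)) ≡ t * t * (+ 2 + k) - + 2 * t * (t - + 1)
bound-identity = solve-∀

bound : ∀ t m → + (t ℕ.+ (t ℕ.+ m ℕ.* (t ℕ.* t))) ≡
                + t * + t * + (2 ℕ.+ m) - + 2 * + t * (+ t - + 1)
bound t m
  rewrite sym (bound-identity (+ t) (+ m)) | sym (ℤ.pos-* t t) | sym (ℤ.pos-* m (t ℕ.* t)) = refl

-- The assumption `2 ℕ.≤ χ G` provides two distinct end classes. For an edgeless graph the
-- right-hand side would be `t * (2 - t)`, which is at most 0 once `t` is at least 2.
leastColors-≤ : {Q : Pred ℕ 0ℓ} → Splitting Q → (s : Searchable (Satisfying Q)) →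
  (t : ℤ) (G : Graph n) → 2 ℕ.≤ χ G →
  (∀ (S A B : Subset n) → IsBipartition (G [ S ]) A B →
     ∃₂ λ (k : ℕ) (c : Coloring n k) →
       Satisfying Q (G [ S ]) c × + ∣ colorsOn c A ∣ ≤ t × + ∣ colorsOn c B ∣ ≤ t) →
  + proj₁ (leastColors (Satisfying Q) s G) ≤ t * t * + χ G - + 2 * t * (t - + 1)
leastColors-≤ {n} {Q} Q-splitting s t G 2≤χ hyp = go t hyp (χ G) 2≤χ (IsLeastPositive.holds χ-least)
  where
  χ-least = proj₂ (leastColors Proper proper-searchable G)

  Hyp : ℤ → Set
  Hyp t = ∀ (S A B : Subset n) → IsBipartition (G [ S ]) A B →
     ∃₂ λ (k : ℕ) (c : Coloring n k) →
       Satisfying Q (G [ S ]) c × + ∣ colorsOn c A ∣ ≤ t × + ∣ colorsOn c B ∣ ≤ t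

  edge⇒positive : ∀ {t u v} → Hyp t → Adj G u v → + 1 ≤ t
  edge⇒positive {t} {u} hyp uv with k , c , _ , le , _ ← hyp _ _ _ (singleton-bipartition G u) =
    ℤ.≤-trans (+≤+ (nonempty⇒0<∣p∣ (c u , ∈-colorsOn⁺ c (x∈p∩q⁺ (Adj⇒∈V G uv , x∈⁅x⁆ u))))) le

  edgeless-absurd : ¬ (∀ {u v} → ¬ Adj G u v)
  edgeless-absurd edgeless = ℕ.<⇒≱ 2≤χ
    (IsLeastPositive.minimal χ-least 1 (s≤s z≤n) (const zero , λ _ _ uv _ → edgeless uv))

  -- Generalizing `χ G` to `k` allows matching it as `suc (suc m)`, with `m` the number of inner
  -- classes.
  go : ∀ t → Hyp t → ∀ k → 2 ℕ.≤ k → ColorableWith Proper G k →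
       + proj₁ (leastColors (Satisfying Q) s G) ≤ t * t * + k - + 2 * t * (t - + 1)
  go (+ suc T) hyp (suc (suc m)) (s≤s (s≤s z≤n)) φ = ℤ.≤-trans
    (+≤+ (IsLeastPositive.minimal (proj₂ (leastColors (Satisfying Q) s G)) _ (s≤s z≤n)
      (colorable Q-splitting G φ hypℕ)))
    (ℤ.≤-reflexive (bound (suc T) m))
    where
    hypℕ : BipartiteColorable Q G (suc T)
    hypℕ S A B bip with k , c , sat , a≤ , b≤ ← hyp S A B bip =
      k , c , sat , ℤ.drop‿+≤+ a≤ , ℤ.drop‿+≤+ b≤
  -- For `t` at most 0 an edge would contradict `edge⇒positive`; without edges one color suffices,
  -- against `2≤χ`.
  go (+ zero)  hyp _ _ _ = ⊥-elim (edgeless-absurd (λ uv → absurd (edge⇒positive hyp uv)))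
    where
    absurd : ¬ (+ 1 ≤ + 0)
    absurd (+≤+ ())
  go -[1+ _ ] hyp _ _ _ = ⊥-elim (edgeless-absurd (λ uv → absurd (edge⇒positive hyp uv)))
    where
    absurd : ∀ {j} → ¬ (+ 1 ≤ -[1+ j ])
    absurd ()

lemma1p3 : ∀ {n : ℕ} (t : ℤ) (G : Graph n) → 2 ℕ.≤ χ G →
    ( (∀ (S A B : Subset n) → IsBipartition (G [ S ]) A B →
    ∃₂ λ (k : ℕ) (c : Coloring n k) →
    ProperOdd (G [ S ]) c × + ∣ colorsOn c A ∣ ≤ t × + ∣ colorsOn c B ∣ ≤ t) →
    + χo G ≤ t * t * + χ G - + 2 * t * (t - + 1) )
    ×
    ( (∀ (S A B : Subset n) → IsBipartition (G [ S ]) A B →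
    ∃₂ λ (k : ℕ) (c : Coloring n k) →
    ProperConflictFree (G [ S ]) c × + ∣ colorsOn c A ∣ ≤ t × + ∣ colorsOn c B ∣ ≤ t) →
    + χpcf G ≤ t * t * + χ G - + 2 * t * (t - + 1) )
lemma1p3 t G 2≤χ =
    leastColors-≤ odd-splitting properOdd-searchable t G 2≤χ
  , leastColors-≤ one-splitting properConflictFree-searchable t G 2≤χ
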